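{- For every even integer $k \ge 4$ and all integers $p \ge k+2$ and $q \ge k+1$, $$r_k(p,q) \ge 2\cdot\bigl(r_k(p-1,q)-1\bigr)+1.$$ For every odd integer $k \ge 5$ and all integers $p \ge k+2$ and $q \ge k+2$, the same inequality $$r_k(p,q) \ge 2\cdot\bigl(r_k(p-1,q)-1\bigr)+1$$ holds.
   Context: For integers $k,p,q$, the Ramsey number $r_k(p,q)$ is the smallest integer $N$ such that for every coloring of all $k$-element subsets of $\{1,\dots,N\}$ with the colors red and blue, there exist either $p$ elements of $\{1,\dots,N\}$ all of whose $k$-element subsets are red, or $q$ elements of $\{1,\dots,N\}$ all of whose $k$-element subsets are blue. -}

module Defs where

open import Data.Empty using (⊥-elim-irr)
open import Data.Fin.Subset
  using (Subset; inside; outside; ⊤; ⊥; _⊆_; ∣_∣)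
open import Data.Fin.Subset.Properties
  using (_⊆?_; anySubset?; drop-∷-⊆; out⊆; s⊆s; ⊥⊆; ⊆-trans; ∣⊥∣≡0; ∣⊤∣≡n)
open import Data.Nat.Base
open import Data.Nat.Properties
open import Data.Product.Base using (∃; _×_; _,_; proj₁; proj₂; map₂)
open import Data.Sum.Base using (_⊎_; inj₁; inj₂) renaming (map to ⊎-map)
open import Data.Vec.Base using ([]; _∷_)
import Data.Vec.Base as Vec
open import Function.Base using (_∘_)
open import Relation.Binary.Definitions using (DecidableEquality)
open import Relation.Binary.PropositionalEquality
open import Relation.Nullary
open import Relation.Nullary.Decidable using (map′; _×-dec_; _⊎-dec_; ¬?; decidable-stable)

data Color : Set where
  red blue : Color

-- The ground set {1, …, N} is represented by Fin N.  The cardinality proof is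
-- irrelevant, so a coloring assigns one color to each k-element subset.
Coloring : ℕ → ℕ → Set
Coloring N k = (e : Subset N) → .(∣ e ∣ ≡ k) → Color

Monochromatic : ∀ {N k} → Color → Coloring N k → Subset N → Set
Monochromatic {k = k} col c S = ∀ e → .(h : ∣ e ∣ ≡ k) → e ⊆ S → c e h ≡ col

HasMono : ∀ {N k} → Color → ℕ → Coloring N k → Set
HasMono col m c = ∃ λ S → ∣ S ∣ ≡ m × Monochromatic col c S

RamseyProperty : (k p q N : ℕ) → Set
RamseyProperty k p q N = (c : Coloring N k) → HasMono red p c ⊎ HasMono blue q c

IsRamseyNumber : (k p q N : ℕ) → Set
IsRamseyNumber k p q N =
  RamseyProperty k p q N × (∀ M → RamseyProperty k p q M → N ≤ M)

-- For r to be a total function, "the smallest N" needs Ramsey's theorem for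
-- hypergraphs and, constructively, decidability of the Ramsey property.

private
  MonoIn : ∀ {N k} → Color → ℕ → Coloring N k → Subset N → Set
  MonoIn col m c U = ∃ λ S → S ⊆ U × ∣ S ∣ ≡ m × Monochromatic col c S

  -- The colorings of subsets avoiding, respectively containing, the first
  -- element; the latter is the link, a coloring of k-element subsets.
  tailColoring : ∀ {N k} → Coloring (suc N) k → Coloring N k
  tailColoring c e h = c (outside ∷ e) h

  link : ∀ {N k} → Coloring (suc N) (suc k) → Coloring N k
  link c e h = c (inside ∷ e) (cong suc h)

  ∣p∣≡0⇒p≡⊥ : ∀ {N} (p : Subset N) → ∣ p ∣ ≡ 0 → p ≡ ⊥
  ∣p∣≡0⇒p≡⊥ []            _ = refl
  ∣p∣≡0⇒p≡⊥ (outside ∷ p) h = cong (outside ∷_) (∣p∣≡0⇒p≡⊥ p h)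

  shrink : ∀ {N} m (U : Subset N) → m ≤ ∣ U ∣ → ∃ λ S → S ⊆ U × ∣ S ∣ ≡ m
  shrink {N} zero U             _       = ⊥ , ⊥⊆ , ∣⊥∣≡0 N
  shrink (suc m) (inside ∷ U)  (s≤s m≤) =
    let S , S⊆U , eq = shrink m U m≤ in inside ∷ S , s⊆s S⊆U , cong suc eq
  shrink (suc m) (outside ∷ U) m≤ =
    let S , S⊆U , eq = shrink (suc m) U m≤ in outside ∷ S , s⊆s S⊆U , eq

  none : ∀ {N k col} (c : Coloring N (suc k)) U → MonoIn col 0 c U
  none {N} {k} c U = ⊥ , ⊥⊆ , ∣⊥∣≡0 N , λ e h e⊆⊥ → ⊥-elim-irr (absurd e h e⊆⊥)
    where
    absurd : ∀ {N} (e : Subset N) → ∣ e ∣ ≡ suc k → e ⊆ ⊥ → _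
    absurd (inside  ∷ e) h e⊆⊥ with () ← e⊆⊥ Vec.here
    absurd (outside ∷ e) h e⊆⊥ = absurd e h (drop-∷-⊆ e⊆⊥)

  skip : ∀ {N k col m} (c : Coloring (suc N) k) {s U} →
         MonoIn col m (tailColoring c) U → MonoIn col m c (s ∷ U)
  skip {N} {k} {col} c (S , S⊆U , eq , mono) = outside ∷ S , out⊆ S⊆U , eq , mono′
    where
    mono′ : Monochromatic col c (outside ∷ S)
    mono′ (inside  ∷ e) h e⊆ with () ← e⊆ Vec.here
    mono′ (outside ∷ e) h e⊆ = mono e h (drop-∷-⊆ e⊆)

  weaken : ∀ {N k col m} {c : Coloring N k} {S U} → S ⊆ U →
           MonoIn col m c S → MonoIn col m c U
  weaken S⊆U (T , T⊆S , rest) = T , ⊆-trans T⊆S S⊆U , rest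

  add : ∀ {N k col m} (c : Coloring (suc N) (suc k)) {S U} → S ⊆ U →
        Monochromatic col (link c) S → MonoIn col m (tailColoring c) S →
        MonoIn col (suc m) c (inside ∷ U)
  add {col = col} c S⊆U linkMono (T , T⊆S , eq , mono) =
    inside ∷ T , s⊆s (⊆-trans T⊆S S⊆U) , cong suc eq , mono′
    where
    mono′ : Monochromatic col c (inside ∷ T)
    mono′ (inside  ∷ e) h e⊆ =
      linkMono e (suc-injective h) (⊆-trans (drop-∷-⊆ e⊆) T⊆S)
    mono′ (outside ∷ e) h e⊆ = mono e h (drop-∷-⊆ e⊆)

  Bound : (k p q R : ℕ) → Set
  Bound k p q R = ∀ {N} (U : Subset N) → R ≤ ∣ U ∣ → (c : Coloring N k) →
                  MonoIn red p c U ⊎ MonoIn blue q c U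

  step : ∀ {k p q A B C} → Bound (suc k) p (suc q) A → Bound (suc k) (suc p) q B →
         Bound k A B C → Bound (suc k) (suc p) (suc q) (suc C)
  step fewerRed fewerBlue onLink = go
    where
    go : Bound _ _ _ _
    go (outside ∷ U) R≤ c = ⊎-map (skip c) (skip c) (go U R≤ (tailColoring c))
    go (inside  ∷ U) (s≤s R≤) c with onLink U R≤ (link c)
    ... | inj₁ (S , S⊆U , ∣S∣ , mono) =
      ⊎-map (add c S⊆U mono) (skip c ∘ weaken S⊆U)
            (fewerRed S (≤-reflexive (sym ∣S∣)) (tailColoring c))
    ... | inj₂ (S , S⊆U , ∣S∣ , mono) =
      ⊎-map (skip c ∘ weaken S⊆U) (add c S⊆U mono)
            (fewerBlue S (≤-reflexive (sym ∣S∣)) (tailColoring c))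

  bound : ∀ k p q → ∃ (Bound k p q)
  bound zero p q = p + q , go
    where
    single : ∀ {N col} (c : Coloring N 0) → c ⊥ (∣⊥∣≡0 N) ≡ col →
             ∀ S → Monochromatic col c S
    single {N} {col} c eq S e h _ = helper (∣p∣≡0⇒p≡⊥ e (recompute (∣ e ∣ ≟ 0) h))
      where
      helper : e ≡ ⊥ → c e h ≡ col
      helper refl = eq

    go : Bound 0 p q (p + q)
    go {N} U R≤ c with c ⊥ (∣⊥∣≡0 N) in eq
    ... | red  = let S , S⊆U , ∣S∣ = shrink p U (m+n≤o⇒m≤o p R≤)
                 in inj₁ (S , S⊆U , ∣S∣ , single c eq S)
    ... | blue = let S , S⊆U , ∣S∣ = shrink q U (m+n≤o⇒n≤o p R≤)
                 in inj₂ (S , S⊆U , ∣S∣ , single c eq S)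
  bound (suc k) zero    q       = 0 , λ U _ c → inj₁ (none c U)
  bound (suc k) (suc p) zero    = 0 , λ U _ c → inj₂ (none c U)
  bound (suc k) (suc p) (suc q) =
    let A , fewerRed  = bound (suc k) p (suc q)
        B , fewerBlue = bound (suc k) (suc p) q
        C , onLink    = bound k A B
    in suc C , step fewerRed fewerBlue onLink

  ramsey : ∀ k p q → ∃ (RamseyProperty k p q)
  ramsey k p q = N , λ c → ⊎-map (map₂ proj₂) (map₂ proj₂)
                             (proj₂ (bound k p q) ⊤ (≤-reflexive (sym (∣⊤∣≡n N))) c)
    where N = proj₁ (bound k p q)

infix 4 _≟ᶜ_
_≟ᶜ_ : DecidableEquality Color
red  ≟ᶜ red  = yes refl
red  ≟ᶜ blue = no λ ()
blue ≟ᶜ red  = no λ ()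
blue ≟ᶜ blue = yes refl

monochromatic? : ∀ {N k} col (c : Coloring N k) S → Dec (Monochromatic col c S)
monochromatic? {N} {k} col c S = map′ to from (¬? (anySubset? bad?))
  where
  Bad : Subset N → Set
  Bad e = e ⊆ S × ∃ λ (h : ∣ e ∣ ≡ k) → c e h ≢ col

  bad? : ∀ e → Dec (Bad e)
  bad? e with e ⊆? S | ∣ e ∣ ≟ k
  ... | no  e⊈S | _      = no (e⊈S ∘ proj₁)
  ... | yes _   | no  ≢k = no (≢k ∘ proj₁ ∘ proj₂)
  ... | yes e⊆S | yes h  = map′ (λ ≢col → e⊆S , h , ≢col) (proj₂ ∘ proj₂) (¬? (c e h ≟ᶜ col))

  to : ¬ ∃ Bad → Monochromatic col c S
  to ¬bad e h e⊆S = decidable-stable (c e h ≟ᶜ col) λ ≢col →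
    ¬bad (e , e⊆S , recompute (∣ e ∣ ≟ k) h , ≢col)

  from : Monochromatic col c S → ¬ ∃ Bad
  from mono (e , e⊆S , h , ≢col) = ≢col (mono e h e⊆S)

hasMono? : ∀ {N k} col m (c : Coloring N k) → Dec (HasMono col m c)
hasMono? col m c = anySubset? λ S → (∣ S ∣ ≟ m) ×-dec monochromatic? col c S

private
  PartialColoring : ∀ {N} → (Subset N → Set) → Set
  PartialColoring Q = ∀ e → .(Q e) → Color

  _≗ᶜ_ : ∀ {N} {Q : Subset N → Set} (c d : PartialColoring Q) → Set
  _≗ᶜ_ {Q = Q} c d = ∀ e → .(h : Q e) → c e h ≡ d e h

  glue : ∀ {N} {Q : Subset (suc N) → Set} →
         PartialColoring (Q ∘ (inside ∷_)) → PartialColoring (Q ∘ (outside ∷_)) →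
         PartialColoring Q
  glue c d (inside  ∷ e) h = c e h
  glue c d (outside ∷ e) h = d e h

  allColorings? : ∀ {N} (Q : Subset N → Set) → (∀ e → Dec (Q e)) →
                  (P : PartialColoring Q → Set) → (∀ {c d} → c ≗ᶜ d → P c → P d) →
                  (∀ c → Dec (P c)) → Dec (∀ c → P c)
  allColorings? {zero} Q Q? P resp P? =
    map′ to (λ all → all (λ _ _ → red) , all (λ _ _ → blue))
         (P? (λ _ _ → red) ×-dec P? (λ _ _ → blue))
    where
    to : P (λ _ _ → red) × P (λ _ _ → blue) → ∀ c → P c
    to (r , b) c with Q? []
    ... | no ¬h = resp (λ { [] h → ⊥-elim-irr (¬h h) }) r
    ... | yes h with c [] h in eq
    ...   | red  = resp (λ { [] _ → sym eq }) r
    ...   | blue = resp (λ { [] _ → sym eq }) b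
  allColorings? {suc N} Q Q? P resp P? =
    map′ (λ all c → resp (λ { (inside ∷ _) _ → refl ; (outside ∷ _) _ → refl })
                      (all (λ e → c (inside ∷ e)) (λ e → c (outside ∷ e))))
         (λ all c d → all (glue c d))
         (allColorings? (Q ∘ (inside ∷_)) (Q? ∘ (inside ∷_)) (λ c → ∀ d → P (glue c d))
           (λ c≗ all d → resp (λ { (inside ∷ e) h → c≗ e h ; (outside ∷ _) _ → refl }) (all d))
           (λ c → allColorings? (Q ∘ (outside ∷_)) (Q? ∘ (outside ∷_)) (λ d → P (glue c d))
             (λ d≗ → resp (λ { (inside ∷ _) _ → refl ; (outside ∷ e) h → d≗ e h }))
             (λ d → P? (glue c d))))

ramseyProperty? : ∀ k p q N → Dec (RamseyProperty k p q N)
ramseyProperty? k p q N =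
  allColorings? (λ e → ∣ e ∣ ≡ k) (λ e → ∣ e ∣ ≟ k) _
    (λ c≗d → ⊎-map (transport c≗d) (transport c≗d))
    (λ c → hasMono? red p c ⊎-dec hasMono? blue q c)
  where
  transport : ∀ {col m} {c d : Coloring N k} → (∀ e → .(h : ∣ e ∣ ≡ k) → c e h ≡ d e h) →
              HasMono col m c → HasMono col m d
  transport c≗d (S , ∣S∣ , mono) =
    S , ∣S∣ , λ e h e⊆S → trans (sym (c≗d e h)) (mono e h e⊆S)

private
  least : ∀ {P : ℕ → Set} → (∀ n → Dec (P n)) → ∀ n → P n →
          ∃ λ m → P m × (∀ i → P i → m ≤ i)
  least P? zero    Pn = zero , Pn , λ _ _ → z≤n
  least {P} P? (suc n) Pn with P? zero
  ... | yes P0 = zero , P0 , λ _ _ → z≤n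
  ... | no ¬P0 with least (P? ∘ suc) n Pn
  ...   | m , Pm , min = suc m , Pm , min′
    where
    min′ : ∀ i → P i → suc m ≤ i
    min′ zero    P0 = contradiction P0 ¬P0
    min′ (suc i) Pi = s≤s (min i Pi)

-- Abstract so that the witness never unfolds to its search; the predicate
-- determines it uniquely.
abstract
  ramseyNumber : ∀ k p q → ∃ (IsRamseyNumber k p q)
  ramseyNumber k p q =
    let N , ramseyN = ramsey k p q in least (ramseyProperty? k p q) N ramseyN

-- For p, q ≥ 1 the property fails at N = 0, so then r k p q ≥ 1 and r k p q ∸ 1
-- is a genuine subtraction.
r : (k p q : ℕ) → ℕ
r k p q = proj₁ (ramseyNumber k p q)

r-isRamseyNumber : ∀ k p q → IsRamseyNumber k p q (r k p q)
r-isRamseyNumber k p q = proj₂ (ramseyNumber k p q)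

{-# OPTIONS --safe #-}
module Submission where

-- Both inequalities come from one doubling construction.  Let c color the
-- k-subsets of an N-element set with no red (p - 1)-set and no blue q-set.
-- Take two disjoint copies of the set, color each copy by c, and color an edge
-- with i vertices in the first copy and j in the second (i, j ≥ 1, i + j = k)
-- by its type (i, j) alone: red if j = 1, blue if j = 2, and otherwise red or
-- blue according as i is odd or even.
--
-- A monochromatic set with a vertices in the first copy and b in the second
-- contains an edge of every type (i, j) with i ≤ a and j ≤ b.  A red p-set
-- meets each copy in at most p - 2 vertices, so a, b ≥ 2, and a blue type fits
-- (blueType): (2, k - 2) if b ≥ k - 2, (k - 2, 2) if a ≥ k - 2, and otherwise
-- one with i = a or i = a - 1, whichever is even.  A blue q-set meets each copy
-- in at most q - 1 vertices, so a, b ≥ 1, and a red type fits (redType): here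
-- (1, k - 1), (k - 1, 1), or one with i = a or i = a - 1, whichever is odd.
-- The latter choice fails only at i = a = k - 2, when k is odd; then (k - 4, 4)
-- is red and it fits if a + b ≥ k + 2, which is why odd k needs the stronger
-- hypothesis on q.
--
-- Read contrapositively, if N + N has the Ramsey property for (p, q) then N has
-- it for (p - 1, q) (halve).  The Ramsey property passes to larger sets
-- (ramsey-mono), so with N = r k (p - 1) q - 1 it fails on every set of at most
-- 2 N elements.

open import Defs
open import Data.Empty using (⊥-elim-irr)
open import Data.Fin.Subset using (Subset; inside; outside; ⊥; _⊆_; ∣_∣)
open import Data.Fin.Subset.Properties
  using (drop-∷-⊆; out⊆; s⊆s; ⊥⊆; ⊆-trans; ∣⊥∣≡0)
open import Data.Nat.Base
  using (ℕ; zero; suc; _≤_; _≥_; _<_; _≤′_; ≤′-refl; ≤′-step; z≤n; s≤s; s≤s⁻¹;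
         _+_; _*_; _∸_)
open import Data.Nat.Divisibility using (_∣_; _∤_; divides-refl)
open import Data.Nat.Properties
open import Data.Product.Base using (_×_; _,_; ∃; proj₁; proj₂)
open import Data.Sum.Base using (_⊎_; inj₁; inj₂) renaming (map to ⊎-map)
open import Data.Vec.Base using ([]; _∷_; _++_; take; drop; splitAt; here)
open import Data.Vec.Properties using (take++drop≡id; ++-injective)
open import Relation.Binary.PropositionalEquality
open import Relation.Nullary using (yes; no; ¬_; contradiction)

-- Subsets of a given size, and subsets of a disjoint union

subsetOfSize : ∀ {N} m (U : Subset N) → m ≤ ∣ U ∣ → ∃ λ S → S ⊆ U × ∣ S ∣ ≡ m
subsetOfSize {N} zero U             _        = ⊥ , ⊥⊆ , ∣⊥∣≡0 N
subsetOfSize (suc m) (inside ∷ U)  (s≤s m≤) =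
  let S , S⊆U , eq = subsetOfSize m U m≤ in inside ∷ S , s⊆s S⊆U , cong suc eq
subsetOfSize (suc m) (outside ∷ U) m≤       =
  let S , S⊆U , eq = subsetOfSize (suc m) U m≤ in outside ∷ S , s⊆s S⊆U , eq

∣++∣ : ∀ {M N} (A : Subset M) (B : Subset N) → ∣ A ++ B ∣ ≡ ∣ A ∣ + ∣ B ∣
∣++∣ []            B = refl
∣++∣ (inside  ∷ A) B = cong suc (∣++∣ A B)
∣++∣ (outside ∷ A) B = ∣++∣ A B

++-⊆ : ∀ {M N} {A A′ : Subset M} {B B′ : Subset N} →
       A ⊆ A′ → B ⊆ B′ → A ++ B ⊆ A′ ++ B′
++-⊆ {A = []}          {[]}           _    B⊆ = B⊆
++-⊆ {A = inside ∷ _}  {outside ∷ _}  A⊆   _  with () ← A⊆ here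
++-⊆ {A = inside ∷ _}  {inside ∷ _}   A⊆   B⊆ = s⊆s (++-⊆ (drop-∷-⊆ A⊆) B⊆)
++-⊆ {A = outside ∷ _} {_ ∷ _}        A⊆   B⊆ = out⊆ (++-⊆ (drop-∷-⊆ A⊆) B⊆)

-- Types of crossing edges

-- Red at odd numbers, blue at even ones.
stripe : ℕ → Color
stripe 0             = blue
stripe 1             = red
stripe (suc (suc i)) = stripe i

stripe-even : ∀ {n} → 2 ∣ n → stripe n ≡ blue
stripe-even (divides-refl h) = go h
  where
  go : ∀ h → stripe (h * 2) ≡ blue
  go zero    = refl
  go (suc h) = go h

stripe-consecutive : ∀ col n → stripe n ≡ col ⊎ stripe (suc n) ≡ col
stripe-consecutive red  0             = inj₂ refl
stripe-consecutive blue 0             = inj₁ refl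
stripe-consecutive red  1             = inj₁ refl
stripe-consecutive blue 1             = inj₂ refl
stripe-consecutive col  (suc (suc n)) = stripe-consecutive col n

-- The color of an edge with i vertices in the first copy and j in the second.
-- Only i, j ≥ 1 matter.
typeColor : ℕ → ℕ → Color
typeColor i 1 = red
typeColor i 2 = blue
typeColor i _ = stripe i

typeColor-stripe : ∀ i {j} → 3 ≤ j → typeColor i j ≡ stripe i
typeColor-stripe i (s≤s (s≤s (s≤s _))) = refl

-- A type of crossing k-edges, of color col, that fits into a set with a
-- vertices in the first copy and b in the second.
record FittingType (k a b : ℕ) (col : Color) : Set where
  constructor fits
  field
    {i j} : ℕ
    1≤i   : 1 ≤ i
    1≤j   : 1 ≤ j
    i≤a   : i ≤ a
    j≤b   : j ≤ b
    i+j≡k : i + j ≡ k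
    color : typeColor i j ≡ col

-- A type with j ≥ 3, whose color is therefore given by the parity of i.  Here
-- and below, k ≥ 4 is written 4 + n.
stripeType : ∀ {n a b col} i → 1 ≤ i → i ≤ 1 + n → i ≤ a → 4 + n ≤ i + b →
             stripe i ≡ col → FittingType (4 + n) a b col
stripeType {n} i 1≤i i≤1+n i≤a k≤i+b eq =
  fits 1≤i (≤-trans (s≤s z≤n) 3≤j) i≤a (m≤n+o⇒m∸n≤o (4 + n) i k≤i+b)
       (m+[n∸m]≡n (≤-trans i≤1+n (m≤n+m (1 + n) 3)))
       (trans (typeColor-stripe i 3≤j) eq)
  where
  3≤j : 3 ≤ 4 + n ∸ i
  3≤j = m+n≤o⇒m≤o∸n 3 (+-monoʳ-≤ 3 i≤1+n)

typeColor-2 : ∀ n → typeColor 2 (2 + n) ≡ blue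
typeColor-2 zero    = refl
typeColor-2 (suc n) = refl

other-≥ : ∀ {l m x y} → x ≤ m → l + m ≤ x + y → l ≤ y
other-≥ {l} {m} {x} {y} x≤m le = +-cancelʳ-≤ m l y
  (≤-trans le (≤-trans (+-monoˡ-≤ y x≤m) (≤-reflexive (+-comm m y))))

blueType : ∀ {n a b} → 2 ≤ a → 2 ≤ b → 6 + n ≤ a + b →
           FittingType (4 + n) a b blue
blueType {n} {a} {b} 2≤a 2≤b k+2≤a+b with 2 + n ≤? b | 2 + n ≤? a
... | yes k-2≤b | _         =
  fits (s≤s z≤n) (s≤s z≤n) 2≤a k-2≤b refl (typeColor-2 n)
... | no _      | yes k-2≤a =
  fits (s≤s z≤n) (s≤s z≤n) k-2≤a 2≤b (+-comm (2 + n) 2) refl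
... | no k-2≰b  | no k-2≰a  = middle a 2≤a (s≤s⁻¹ (≰⇒> k-2≰a)) k+2≤a+b
  where
  middle : ∀ a → 2 ≤ a → a ≤ 1 + n → 6 + n ≤ a + b → FittingType (4 + n) a b blue
  middle (suc a) (s≤s 1≤a) 1+a≤1+n k+2≤ with stripe-consecutive blue a
  ... | inj₁ eq = stripeType a 1≤a (≤-trans (n≤1+n a) 1+a≤1+n) (n≤1+n a)
                    (≤-trans (n≤1+n _) (s≤s⁻¹ k+2≤)) eq
  ... | inj₂ eq = stripeType (suc a) (s≤s z≤n) 1+a≤1+n ≤-refl
                    (≤-trans (m≤n+m (4 + n) 2) k+2≤) eq

-- The bound m = a + b that forces a red type to fit.  For odd k, k + 1 is not
-- enough: if a = k - 2 and b = 3, only the blue types (k - 2, 2) and (k - 3, 3)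
-- fit.
LargeFor : ℕ → ℕ → Set
LargeFor k m = (2 ∣ k × k + 1 ≤ m) ⊎ (5 ≤ k × k + 2 ≤ m)

largeFor⇒k<m : ∀ {k m} → LargeFor k m → k < m
largeFor⇒k<m {k} (inj₁ (_ , le)) = ≤-trans (≤-reflexive (+-comm 1 k)) le
largeFor⇒k<m {k} (inj₂ (_ , le)) =
  ≤-trans (≤-trans (n≤1+n _) (≤-reflexive (+-comm 2 k))) le

redType : ∀ {n a b} → 1 ≤ a → 1 ≤ b → LargeFor (4 + n) (a + b) →
          FittingType (4 + n) a b red
redType {n} {a} {b} 1≤a 1≤b large with 3 + n ≤? b | 3 + n ≤? a
... | yes k-1≤b | _         = fits (s≤s z≤n) (s≤s z≤n) 1≤a k-1≤b refl refl
... | no _      | yes k-1≤a =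
  fits (s≤s z≤n) (s≤s z≤n) k-1≤a 1≤b (+-comm (3 + n) 1) refl
... | no k-1≰b  | no k-1≰a  = middle a (s≤s⁻¹ (≰⇒> k-1≰a)) large
  where
  b≤k-2 : b ≤ 2 + n
  b≤k-2 = s≤s⁻¹ (≰⇒> k-1≰b)

  -- The case of odd a = k - 2, where the type (a, 2) is blue and (a - 1, 3) is
  -- blue too.
  corner : stripe (2 + n) ≡ red → LargeFor (4 + n) (2 + n + b) →
           FittingType (4 + n) (2 + n) b red
  corner eq (inj₁ (2∣k , _)) with () ← trans (sym eq) (stripe-even 2∣k)
  corner eq (inj₂ (s≤s (s≤s (s≤s (s≤s 1≤n))) , k+2≤)) =
    stripeType n 1≤n (n≤1+n n) (m≤n+m n 2) k≤n+b eq
    where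
    k≤n+b : 4 + n ≤ n + b
    k≤n+b = s≤s⁻¹ (s≤s⁻¹ (≤-trans (≤-reflexive (+-comm 2 (4 + n))) k+2≤))

  middle : ∀ a → a ≤ 2 + n → LargeFor (4 + n) (a + b) → FittingType (4 + n) a b red
  middle zero    _      large =
    contradiction (≤-trans b≤k-2 (m≤n+m (2 + n) 2)) (<⇒≱ (largeFor⇒k<m large))
  middle (suc a) 1+a≤k-2 large with stripe-consecutive red a
  ... | inj₁ eq = stripeType a 1≤a′ (s≤s⁻¹ 1+a≤k-2) (n≤1+n a) k≤a+b eq
    where
    k≤a+b : 4 + n ≤ a + b
    k≤a+b = s≤s⁻¹ (largeFor⇒k<m large)
    1≤a′ : 1 ≤ a
    1≤a′ = other-≥ b≤k-2
      (≤-trans (n≤1+n _) (≤-trans k≤a+b (≤-reflexive (+-comm a b))))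
  ... | inj₂ eq with suc a ≤? 1 + n
  ...   | yes 1+a≤k-3 = stripeType (suc a) (s≤s z≤n) 1+a≤k-3 ≤-refl
                          (≤-trans (n≤1+n _) (largeFor⇒k<m large)) eq
  ...   | no  1+a≰k-3 with refl ← ≤-antisym 1+a≤k-2 (≰⇒> 1+a≰k-3) = corner eq large

-- The doubled coloring

-- The color of the edge with parts A and B in the two copies.  The first two
-- cases exclude each other when ∣ A ∣ + ∣ B ∣ = k > 0.
partsColor : ∀ {N k} → Coloring N k → Subset N → Subset N → Color
partsColor {k = k} c A B with ∣ A ∣ ≟ k | ∣ B ∣ ≟ k
... | yes h | _     = c A h
... | no _  | yes h = c B h
... | no _  | no _  = typeColor ∣ A ∣ ∣ B ∣

-- The two copies are the first N and the last N elements of the ground set.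
doubled : ∀ {N k} → Coloring N k → Coloring (N + N) k
doubled {N} c e _ = partsColor c (take N e) (drop N e)

module _ {N k : ℕ} (c : Coloring N k) where

  partsColor-first : ∀ A B → .(h : ∣ A ∣ ≡ k) → partsColor c A B ≡ c A h
  partsColor-first A B h with ∣ A ∣ ≟ k | ∣ B ∣ ≟ k
  ... | yes _ | _ = refl
  ... | no ≢k | _ = ⊥-elim-irr (≢k h)

  partsColor-second : ∀ A B → ∣ A ∣ ≢ k → .(h : ∣ B ∣ ≡ k) → partsColor c A B ≡ c B h
  partsColor-second A B ∣A∣≢k h with ∣ A ∣ ≟ k | ∣ B ∣ ≟ k
  ... | yes ≡k | _     = contradiction ≡k ∣A∣≢k
  ... | no _   | yes _ = refl
  ... | no _   | no ≢k = ⊥-elim-irr (≢k h)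

  partsColor-crossing : ∀ A B → ∣ A ∣ ≢ k → ∣ B ∣ ≢ k →
                        partsColor c A B ≡ typeColor ∣ A ∣ ∣ B ∣
  partsColor-crossing A B ∣A∣≢k ∣B∣≢k with ∣ A ∣ ≟ k | ∣ B ∣ ≟ k
  ... | yes ≡k | _      = contradiction ≡k ∣A∣≢k
  ... | no _   | yes ≡k = contradiction ≡k ∣B∣≢k
  ... | no _   | no _   = refl

  module _ {col : Color} (A B : Subset N)
           (mono : Monochromatic col (doubled c) (A ++ B)) where

    partsColor-mono : ∀ E F → .(∣ E ∣ + ∣ F ∣ ≡ k) → E ⊆ A → F ⊆ B →
                      partsColor c E F ≡ col
    partsColor-mono E F h E⊆A F⊆B =
      trans (sym (cong₂ (partsColor c) take≡E drop≡F))
            (mono (E ++ F) (trans (∣++∣ E F) h) (++-⊆ E⊆A F⊆B))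
      where
      parts : take N (E ++ F) ≡ E × drop N (E ++ F) ≡ F
      parts = ++-injective (take N (E ++ F)) E (take++drop≡id N (E ++ F))
      take≡E = proj₁ parts
      drop≡F = proj₂ parts

    mono-first : Monochromatic col c A
    mono-first e h e⊆A = trans (sym (partsColor-first e ⊥ h))
      (partsColor-mono e ⊥ (trans (cong₂ _+_ h (∣⊥∣≡0 N)) (+-identityʳ k)) e⊆A ⊥⊆)

    mono-second : 0 < k → Monochromatic col c B
    mono-second 0<k e h e⊆B = trans (sym (partsColor-second ⊥ e ∣⊥∣≢k h))
      (partsColor-mono ⊥ e (cong₂ _+_ (∣⊥∣≡0 N) h) ⊥⊆ e⊆B)
      where
      ∣⊥∣≢k : ∣ ⊥ {N} ∣ ≢ k
      ∣⊥∣≢k eq = <⇒≢ 0<k (trans (sym (∣⊥∣≡0 N)) eq)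

    mono-fittingType : ∀ {col′} → FittingType k ∣ A ∣ ∣ B ∣ col′ → col′ ≡ col
    mono-fittingType (fits {i} {j} 1≤i 1≤j i≤∣A∣ j≤∣B∣ i+j≡k color)
      with subsetOfSize i A i≤∣A∣ | subsetOfSize j B j≤∣B∣
    ... | E , E⊆A , refl | F , F⊆B , refl =
      trans (sym color)
        (trans (sym (partsColor-crossing E F
                       (λ ≡k → <⇒≢ (m<m+n i 1≤j) (trans ≡k (sym i+j≡k)))
                       (λ ≡k → <⇒≢ (m<n+m j 1≤i) (trans ≡k (sym i+j≡k)))))
               (partsColor-mono E F i+j≡k E⊆A F⊆B))

hasMono-⊆ : ∀ {N k col m} {c : Coloring N k} {U} → Monochromatic col c U →
            m ≤ ∣ U ∣ → HasMono col m c
hasMono-⊆ {m = m} {U = U} mono m≤ =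
  let S , S⊆U , ∣S∣ = subsetOfSize m U m≤
  in S , ∣S∣ , λ e h e⊆S → mono e h (⊆-trans e⊆S S⊆U)

-- If a set of size s + m does not meet a copy in at least m vertices, then it
-- meets both in more than s.
hasMono-doubled : ∀ {N k col col′ m} s (c : Coloring N k) → 0 < k → col′ ≢ col →
  (∀ {a b} → s < a → s < b → a + b ≡ s + m → FittingType k a b col′) →
  HasMono col (s + m) (doubled c) → HasMono col m c
hasMono-doubled {N} {m = m} s c 0<k col′≢col fit (S , ∣S∣ , mono) with splitAt N S
... | A , B , refl with m ≤? ∣ A ∣ | m ≤? ∣ B ∣
...   | yes m≤∣A∣ | _         = hasMono-⊆ (mono-first c A B mono) m≤∣A∣
...   | no _      | yes m≤∣B∣ = hasMono-⊆ (mono-second c A B mono 0<k) m≤∣B∣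
...   | no m≰∣A∣  | no m≰∣B∣  =
  contradiction (mono-fittingType c A B mono (fit s<∣A∣ s<∣B∣ ∣A∣+∣B∣)) col′≢col
  where
  ∣A∣+∣B∣ : ∣ A ∣ + ∣ B ∣ ≡ s + m
  ∣A∣+∣B∣ = trans (sym (∣++∣ A B)) ∣S∣
  exceeds : ∀ {x y} → x < m → x + y ≡ s + m → s < y
  exceeds x<m eq = other-≥ x<m (s≤s (≤-reflexive (sym eq)))
  s<∣B∣ : s < ∣ B ∣
  s<∣B∣ = exceeds (≰⇒> m≰∣A∣) ∣A∣+∣B∣
  s<∣A∣ : s < ∣ A ∣
  s<∣A∣ = exceeds (≰⇒> m≰∣B∣) (trans (+-comm ∣ B ∣ ∣ A ∣) ∣A∣+∣B∣)

-- The inequality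

halve : ∀ {k p q N} → 4 ≤ k → k + 2 ≤ p → LargeFor k q →
        RamseyProperty k p q (N + N) → RamseyProperty k (p ∸ 1) q N
halve {suc (suc (suc (suc n)))} {suc p} {q} (s≤s (s≤s (s≤s (s≤s _)))) k+2≤p large ramsey c =
  ⊎-map (hasMono-doubled 1 c (s≤s z≤n) (λ ()) blueFits)
        (hasMono-doubled 0 c (s≤s z≤n) (λ ()) redFits)
        (ramsey (doubled c))
  where
  blueFits : ∀ {a b} → 1 < a → 1 < b → a + b ≡ 1 + p → FittingType (4 + n) a b blue
  blueFits 1<a 1<b eq = blueType 1<a 1<b
    (≤-trans (≤-reflexive (+-comm 2 (4 + n))) (≤-trans k+2≤p (≤-reflexive (sym eq))))
  redFits : ∀ {a b} → 0 < a → 0 < b → a + b ≡ q → FittingType (4 + n) a b red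
  redFits 0<a 0<b eq = redType 0<a 0<b (subst (LargeFor (4 + n)) (sym eq) large)

ramsey-mono : ∀ {k p q M N} → M ≤ N → RamseyProperty k p q M → RamseyProperty k p q N
ramsey-mono {k} {p} {q} {M} M≤N = go (≤⇒≤′ M≤N)
  where
  extend : ∀ {N col m} (c : Coloring (suc N) k) →
           HasMono {k = k} col m (λ e h → c (outside ∷ e) h) → HasMono col m c
  extend {col = col} c (S , ∣S∣ , mono) = outside ∷ S , ∣S∣ , mono′
    where
    mono′ : Monochromatic col c (outside ∷ S)
    mono′ (inside  ∷ e) h e⊆ with () ← e⊆ here
    mono′ (outside ∷ e) h e⊆ = mono e h (drop-∷-⊆ e⊆)

  go : ∀ {N} → M ≤′ N → RamseyProperty k p q M → RamseyProperty k p q N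
  go ≤′-refl       ramsey   = ramsey
  go (≤′-step M≤N) ramsey c =
    ⊎-map (extend c) (extend c) (go M≤N ramsey (λ e h → c (outside ∷ e) h))

ramsey⇒0<N : ∀ {k p q N} → 0 < p → 0 < q → RamseyProperty k p q N → 0 < N
ramsey⇒0<N {N = suc N} _   _   _      = s≤s z≤n
ramsey⇒0<N {N = zero}  0<p 0<q ramsey with ramsey (λ _ _ → red)
... | inj₁ ([] , ∣S∣ , _) = contradiction ∣S∣ (<⇒≢ 0<p)
... | inj₂ ([] , ∣S∣ , _) = contradiction ∣S∣ (<⇒≢ 0<q)

r-doubling : ∀ {k p q} → 4 ≤ k → k + 2 ≤ p → LargeFor k q →
             r k p q ≥ 2 * (r k (p ∸ 1) q ∸ 1) + 1
r-doubling {k} {p} {q} 4≤k k+2≤p large = subst (_≤ r k p q) (+-comm 1 (2 * N)) (≰⇒> r≰2N)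
  where
  N = r k (p ∸ 1) q ∸ 1

  0<p-1 : 0 < p ∸ 1
  0<p-1 = m+n≤o⇒m≤o∸n 1 (≤-trans (m≤n+m 2 k) k+2≤p)

  0<r : 0 < r k (p ∸ 1) q
  0<r = ramsey⇒0<N {k} 0<p-1 (≤-trans (s≤s z≤n) (largeFor⇒k<m large))
          (proj₁ (r-isRamseyNumber k (p ∸ 1) q))

  r≰2N : ¬ (r k p q ≤ 2 * N)
  r≰2N r≤2N = <⇒≱ (≤-reflexive (m+[n∸m]≡n 0<r))
    (proj₂ (r-isRamseyNumber k (p ∸ 1) q) N
      (halve 4≤k k+2≤p large
        (ramsey-mono (subst (r k p q ≤_) (cong (N +_) (+-identityʳ N)) r≤2N)
          (proj₁ (r-isRamseyNumber k p q)))))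

theorem4 : (∀ (k p q : ℕ) → 2 ∣ k → k ≥ 4 → p ≥ k + 2 → q ≥ k + 1 →
    r k p q ≥ 2 * (r k (p ∸ 1) q ∸ 1) + 1)
    ×
    (∀ (k p q : ℕ) → 2 ∤ k → k ≥ 5 → p ≥ k + 2 → q ≥ k + 2 →
    r k p q ≥ 2 * (r k (p ∸ 1) q ∸ 1) + 1)
theorem4 =
  (λ k p q 2∣k k≥4 p≥k+2 q≥k+1 → r-doubling k≥4 p≥k+2 (inj₁ (2∣k , q≥k+1))) ,
  (λ k p q _ k≥5 p≥k+2 q≥k+2 →
    r-doubling (≤-trans (n≤1+n 4) k≥5) p≥k+2 (inj₂ (k≥5 , q≥k+2)))
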